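{- Let $(L,\vee,\wedge,{}',0,1)$ be a non-trivial complete orthomodular lattice, let $(T,R)$ be a time frame with reflexive $R$, let $P,F,H,G\colon L^T\to L^T$ denote the tense operators induced by $(T,R)$, let $A,A_1,A_2\in\{P,F\}$, $B,B_1,B_2\in\{H,G\}$ and $p,q\in L^T$. Then the following hold: (i) $p\leq q\rightarrow A_1\big(A_2(p)\odot q\big)$; (ii) $B(p\odot q)\leq A(p)\odot q$; (iii) $B(p)\leq q\rightarrow A(p\odot q)$; (iv) $B_1\big(B_2(p)\odot q\big)\leq p\odot q$; (v) $p\rightarrow q\leq A_1\big(p\rightarrow A_2(q)\big)$; (vi) $B(p\rightarrow q)\odot p\leq A(q)$; (vii) $p\rightarrow B(q)\leq A(p\rightarrow q)$; (viii) $B_1\big(p\rightarrow B_2(q)\big)\odot p\leq q$.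
   Context: An orthomodular lattice is an algebra $(L,\vee,\wedge,{}',0,1)$ such that $(L,\vee,\wedge,0,1)$ is a bounded lattice, $'$ is an antitone involution ($x\leq y$ implies $y'\leq x'$, and $x''=x$), $x\vee x'=1$ and $x\wedge x'=0$ for all $x\in L$, and the orthomodular law holds: if $x\leq y$ then $y=x\vee(y\wedge x')$. It is complete if its underlying lattice is complete; non-trivial means that $L$ has more than one element. On $L$ one defines $x\odot y:=(x\vee y')\wedge y$ and $x\rightarrow y:=(y\wedge x)\vee x'$. A time frame is a pair $(T,R)$ consisting of a non-empty set $T$ and a non-empty binary relation $R\subseteq T\times T$; $s\mathrel R t$ means $(s,t)\in R$. $L^T$ is the set of all functions $T\to L$, with order and operations (including $\odot$ and $\rightarrow$) defined pointwise. The tense operators $P,F,H,G\colon L^T\to L^T$ induced by $(T,R)$ are defined, for $q\in L^T$ and $s\in T$, by $P(q)(s):=\bigvee\{q(t)\mid t\mathrel R s\}$, $F(q)(s):=\bigvee\{q(t)\mid s\mathrel R t\}$, $H(q)(s):=\bigwedge\{q(t)\mid t\mathrel R s\}$, $G(q)(s):=\bigwedge\{q(t)\mid s\mathrel R t\}$. -}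

module Defs where

open import Level using (Level; suc; _⊔_)
open import Data.Product using (∃; ∃₂; _×_; proj₁; proj₂)
open import Relation.Binary using (Rel; Poset)
open import Relation.Binary.Lattice using (BoundedLattice)
open import Relation.Nullary using (¬_)
open import Relation.Unary using (Pred; _∈_)

record OrthomodularLattice (c ℓ₁ ℓ₂ : Level) : Set (suc (c ⊔ ℓ₁ ⊔ ℓ₂)) where
  infix 9 _′
  field
    boundedLattice : BoundedLattice c ℓ₁ ℓ₂

  open BoundedLattice boundedLattice public

  field
    _′             : Carrier → Carrier
    ′-antitone     : ∀ {x y} → x ≤ y → y ′ ≤ x ′
    ′-involutive   : ∀ x → (x ′) ′ ≈ x
    ∨-complement   : ∀ x → x ∨ x ′ ≈ ⊤
    ∧-complement   : ∀ x → x ∧ x ′ ≈ ⊥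
    orthomodular   : ∀ {x y} → x ≤ y → y ≈ x ∨ (y ∧ x ′)

  infixl 8 _⊙_
  infixr 5 _⇨_

  _⊙_ : Carrier → Carrier → Carrier
  x ⊙ y = (x ∨ y ′) ∧ y

  -- Despite the symbol, this is the Sasaki hook, not a Heyting implication.
  _⇨_ : Carrier → Carrier → Carrier
  x ⇨ y = (y ∧ x) ∨ x ′

  NonTrivial : Set (c ⊔ ℓ₁)
  NonTrivial = ∃₂ λ x y → ¬ (x ≈ y)

module _ {c ℓ₁ ℓ₂ : Level} (X : Poset c ℓ₁ ℓ₂) where
  open Poset X

  IsSupremum : {i : Level} → Pred Carrier i → Carrier → Set (c ⊔ ℓ₂ ⊔ i)
  IsSupremum S u = (∀ x → x ∈ S → x ≤ u) × (∀ v → (∀ x → x ∈ S → x ≤ v) → u ≤ v)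

  IsInfimum : {i : Level} → Pred Carrier i → Carrier → Set (c ⊔ ℓ₂ ⊔ i)
  IsInfimum S l = (∀ x → x ∈ S → l ≤ x) × (∀ v → (∀ x → x ∈ S → v ≤ x) → v ≤ l)

  -- Subsets are predicates, so completeness is relative to the universe level i
  -- in which they take values.
  Complete : (i : Level) → Set (c ⊔ ℓ₂ ⊔ suc i)
  Complete i = (S : Pred Carrier i) → ∃ (IsSupremum S) × ∃ (IsInfimum S)

record TimeFrame (t r : Level) : Set (suc (t ⊔ r)) where
  infix 4 _R_
  field
    T          : Set t
    _R_        : Rel T r
    T-nonEmpty : T
    R-nonEmpty : ∃₂ _R_

-- The completeness level is the smallest one containing all the sets
-- { q(t) | t R s } and { q(t) | s R t }.
module Tense {c ℓ₁ ℓ₂ t r : Level}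
             (L : OrthomodularLattice c ℓ₁ ℓ₂)
             (complete : Complete (OrthomodularLattice.poset L) (ℓ₁ ⊔ t ⊔ r))
             (𝕋 : TimeFrame t r) where
  open OrthomodularLattice L
  open TimeFrame 𝕋

  ⋁ : Pred Carrier (ℓ₁ ⊔ t ⊔ r) → Carrier
  ⋁ S = proj₁ (proj₁ (complete S))

  ⋀ : Pred Carrier (ℓ₁ ⊔ t ⊔ r) → Carrier
  ⋀ S = proj₁ (proj₂ (complete S))

  Lᵀ : Set (c ⊔ t)
  Lᵀ = T → Carrier

  infix  4 _≤ᵀ_
  infixl 8 _⊙ᵀ_
  infixr 5 _⇨ᵀ_

  _≤ᵀ_ : Lᵀ → Lᵀ → Set (ℓ₂ ⊔ t)
  p ≤ᵀ q = ∀ s → p s ≤ q s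

  _⊙ᵀ_ : Lᵀ → Lᵀ → Lᵀ
  (p ⊙ᵀ q) s = p s ⊙ q s

  _⇨ᵀ_ : Lᵀ → Lᵀ → Lᵀ
  (p ⇨ᵀ q) s = p s ⇨ q s

  P F H G : Lᵀ → Lᵀ
  P q s = ⋁ λ x → ∃ λ t → t R s × x ≈ q t
  F q s = ⋁ λ x → ∃ λ t → s R t × x ≈ q t
  H q s = ⋀ λ x → ∃ λ t → t R s × x ≈ q t
  G q s = ⋀ λ x → ∃ λ t → s R t × x ≈ q t

{-# OPTIONS --safe #-}
module Submission where

-- Sasaki projection and Sasaki hook form an adjunction, x ⊙ y ≤ z ⇔ x ≤ y ⇨ z.
-- Only its unit and counit are needed: ⊙ is monotone in its first argument, ⇨ in
-- its second, and reflexivity of R makes P, F inflationary and H, G deflationary.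

open import Defs
open import Level using (Level; _⊔_)
open import Data.Product using (_×_; _,_; proj₁; proj₂)
open import Data.Sum using (inj₁; inj₂)
open import Relation.Binary using (Reflexive)
open import Relation.Binary.PropositionalEquality using (refl)
open import Relation.Unary using (_∈_; _∪_; ｛_｝)

module SasakiAdjunction {c ℓ₁ ℓ₂ : Level} (L : OrthomodularLattice c ℓ₁ ℓ₂) where
  open OrthomodularLattice L renaming (refl to ≤-refl)
  open import Relation.Binary.Lattice.Properties.JoinSemilattice joinSemilattice
    using (∨-monotonic)
  open import Relation.Binary.Lattice.Properties.MeetSemilattice meetSemilattice
    using (∧-monotonic)

  x≤x′′ : ∀ x → x ≤ (x ′) ′
  x≤x′′ x = reflexive (Eq.sym (′-involutive x))

  x′′≤x : ∀ x → (x ′) ′ ≤ x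
  x′′≤x x = reflexive (′-involutive x)

  ′-cancel-≤ : ∀ {x y} → y ′ ≤ x ′ → x ≤ y
  ′-cancel-≤ {x} {y} y′≤x′ = trans (x≤x′′ x) (trans (′-antitone y′≤x′) (x′′≤x y))

  ⊙-monoˡ : ∀ {x y} z → x ≤ y → x ⊙ z ≤ y ⊙ z
  ⊙-monoˡ z x≤y = ∧-monotonic (∨-monotonic x≤y ≤-refl) ≤-refl

  ⇨-monoʳ : ∀ {x y} z → x ≤ y → (z ⇨ x) ≤ (z ⇨ y)
  ⇨-monoʳ z x≤y = ∨-monotonic (∧-monotonic x≤y ≤-refl) ≤-refl

  -- Since `y ′` lies below `x ∨ y ′`, the orthomodular law splits that join into `y ′` and its meet
  -- with `(y ′) ′`. Up to the involution this meet is `x ⊙ y`; it also lies below `y`, so both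
  -- pieces are below the hook.
  ⇨-unit : ∀ x y → x ≤ (y ⇨ x ⊙ y)
  ⇨-unit x y = trans (x≤x∨y x (y ′))
    (trans (reflexive (orthomodular (y≤x∨y x (y ′))))
      (∨-least (y≤x∨y _ _)
        (trans (∧-greatest meet≤⊙ (trans (x∧y≤y _ _) (x′′≤x y))) (x≤x∨y _ _))))
    where
    meet≤⊙ : (x ∨ y ′) ∧ (y ′) ′ ≤ x ⊙ y
    meet≤⊙ = ∧-monotonic ≤-refl (x′′≤x y)

  -- The orthomodular law for y ′ ≤ x ′, read through the involution.
  x≤y⇒x⊙y≤x : ∀ {x y} → x ≤ y → x ⊙ y ≤ x
  x≤y⇒x⊙y≤x {x} {y} x≤y = ′-cancel-≤
    (trans (reflexive (orthomodular (′-antitone x≤y)))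
      (∨-least (′-antitone (x∧y≤y _ _))
        (trans (x≤x′′ _) (′-antitone (trans (x∧y≤x _ _) x∨y′≤)))))
    where
    -- The half of De Morgan's law that puts the second orthomodular piece of `x ′` below
    -- `(x ⊙ y) ′`.
    x∨y′≤ : x ∨ y ′ ≤ (x ′ ∧ (y ′) ′) ′
    x∨y′≤ = ∨-least
      (trans (x≤x′′ x) (′-antitone (x∧y≤x _ _)))
      (trans (x≤x′′ (y ′)) (′-antitone (x∧y≤y _ _)))

  -- The hook already contains `x ′`, so joining `x ′` again changes nothing and the left side is at
  -- most `(y ∧ x) ⊙ x`. As `y ∧ x` is below `x`, this is at most `y ∧ x`.
  ⊙-counit : ∀ x y → (x ⇨ y) ⊙ x ≤ y
  ⊙-counit x y = trans (∧-monotonic (∨-least ≤-refl (y≤x∨y _ _)) ≤-refl)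
    (trans (x≤y⇒x⊙y≤x (x∧y≤y y x)) (x∧y≤x y x))

module ReflexiveTense {c ℓ₁ ℓ₂ t r : Level}
                      (L : OrthomodularLattice c ℓ₁ ℓ₂)
                      (complete : Complete (OrthomodularLattice.poset L) (ℓ₁ ⊔ t ⊔ r))
                      (𝕋 : TimeFrame t r)
                      (R-refl : Reflexive (TimeFrame._R_ 𝕋)) where
  open OrthomodularLattice L using (module Eq)
  open Tense L complete 𝕋

  PF-inflationary : ∀ {A} → A ∈ ｛ P ｝ ∪ ｛ F ｝ → ∀ q → q ≤ᵀ A q
  PF-inflationary (inj₁ refl) q s =
    -- Reflexivity makes `s` its own predecessor, so `q s` is one of the joined values.
    proj₁ (proj₂ (proj₁ (complete _))) (q s) (s , R-refl , Eq.refl)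
  PF-inflationary (inj₂ refl) q s =
    proj₁ (proj₂ (proj₁ (complete _))) (q s) (s , R-refl , Eq.refl)

  HG-deflationary : ∀ {B} → B ∈ ｛ H ｝ ∪ ｛ G ｝ → ∀ q → B q ≤ᵀ q
  HG-deflationary (inj₁ refl) q s =
    proj₁ (proj₂ (proj₂ (complete _))) (q s) (s , R-refl , Eq.refl)
  HG-deflationary (inj₂ refl) q s =
    proj₁ (proj₂ (proj₂ (complete _))) (q s) (s , R-refl , Eq.refl)

theorem4p4 : {c ℓ₁ ℓ₂ t r : Level}
    (L : OrthomodularLattice c ℓ₁ ℓ₂) →
    OrthomodularLattice.NonTrivial L →
    (complete : Complete (OrthomodularLattice.poset L) (ℓ₁ ⊔ t ⊔ r))
    (𝕋 : TimeFrame t r) →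
    Reflexive (TimeFrame._R_ 𝕋) →
    let open Tense L complete 𝕋 in
    (A A₁ A₂ B B₁ B₂ : Lᵀ → Lᵀ) →
    A ∈ ｛ P ｝ ∪ ｛ F ｝ → A₁ ∈ ｛ P ｝ ∪ ｛ F ｝ → A₂ ∈ ｛ P ｝ ∪ ｛ F ｝ →
    B ∈ ｛ H ｝ ∪ ｛ G ｝ → B₁ ∈ ｛ H ｝ ∪ ｛ G ｝ → B₂ ∈ ｛ H ｝ ∪ ｛ G ｝ →
    (p q : Lᵀ) →
    (p ≤ᵀ (q ⇨ᵀ A₁ (A₂ p ⊙ᵀ q)))
    × (B (p ⊙ᵀ q) ≤ᵀ (A p ⊙ᵀ q))
    × (B p ≤ᵀ (q ⇨ᵀ A (p ⊙ᵀ q)))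
    × (B₁ (B₂ p ⊙ᵀ q) ≤ᵀ (p ⊙ᵀ q))
    × ((p ⇨ᵀ q) ≤ᵀ A₁ (p ⇨ᵀ A₂ q))
    × ((B (p ⇨ᵀ q) ⊙ᵀ p) ≤ᵀ A q)
    × ((p ⇨ᵀ B q) ≤ᵀ A (p ⇨ᵀ q))
    × ((B₁ (p ⇨ᵀ B₂ q) ⊙ᵀ p) ≤ᵀ q)
theorem4p4 L _ complete 𝕋 R-refl A A₁ A₂ B B₁ B₂ A∈ A₁∈ A₂∈ B∈ B₁∈ B₂∈ p q =
    (λ s → trans (⇨-unit (p s) (q s))
             (⇨-monoʳ (q s) (trans (⊙-monoˡ (q s) (PF-inflationary A₂∈ p s))
                                   (PF-inflationary A₁∈ (A₂ p ⊙ᵀ q) s))))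
  -- No adjunction here: the two sides are compared through `p ⊙ᵀ q`.
  , (λ s → trans (HG-deflationary B∈ (p ⊙ᵀ q) s) (⊙-monoˡ (q s) (PF-inflationary A∈ p s)))
  , (λ s → trans (HG-deflationary B∈ p s)
             (trans (⇨-unit (p s) (q s)) (⇨-monoʳ (q s) (PF-inflationary A∈ (p ⊙ᵀ q) s))))
  , (λ s → trans (HG-deflationary B₁∈ (B₂ p ⊙ᵀ q) s) (⊙-monoˡ (q s) (HG-deflationary B₂∈ p s)))
  , (λ s → trans (⇨-monoʳ (p s) (PF-inflationary A₂∈ q s)) (PF-inflationary A₁∈ (p ⇨ᵀ A₂ q) s))
  , (λ s → trans (⊙-monoˡ (p s) (HG-deflationary B∈ (p ⇨ᵀ q) s))
             (trans (⊙-counit (p s) (q s)) (PF-inflationary A∈ q s)))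
  , (λ s → trans (⇨-monoʳ (p s) (HG-deflationary B∈ q s)) (PF-inflationary A∈ (p ⇨ᵀ q) s))
  -- Both operators are removed under `⊙`, the inner one also under the hook, before the counit
  -- applies.
  , (λ s → trans (⊙-monoˡ (p s) (trans (HG-deflationary B₁∈ (p ⇨ᵀ B₂ q) s)
                                       (⇨-monoʳ (p s) (HG-deflationary B₂∈ q s))))
             (⊙-counit (p s) (q s)))
  where
  open OrthomodularLattice L using (trans)
  open SasakiAdjunction L
  open Tense L complete 𝕋
  open ReflexiveTense L complete 𝕋 R-refl
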